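{- Let $\kappa$ be a regular uncountable cardinal and $\lambda>\kappa$ a cardinal. Suppose $\kappa$ is weakly compact. Then $H^+\xrightarrow{\kappa}(H^+)^2$ for every ideal $H$ on $P_\kappa(\lambda)$ such that $\mathrm{cof}(H)<\mathbf{cov}(\mathbf{M}_{\kappa,\kappa})$.
   Context: For a cardinal $\mu$ and a set $A$, $P_\mu(A)=\{a\subseteq A:|a|<\mu\}$. An ideal on an infinite set $S$ is a collection $K$ of subsets of $S$ containing all singletons, closed under subsets and finite unions, with $S\notin K$; $K^+=P(S)\setminus K$; $\mathrm{cof}(K)$ is the least cardinality of an $X\subseteq K$ with $K=\bigcup_{A\in X}P(A)$. $I_{\kappa,\lambda}$ is the set of all $A\subseteq P_\kappa(\lambda)$ such that $A\cap\{b\in P_\kappa(\lambda):a\subseteq b\}=\emptyset$ for some $a\in P_\kappa(\lambda)$. "Ideal on $P_\kappa(\lambda)$" always means an ideal $H$ on $P_\kappa(\lambda)$ that is $\kappa$-complete (closed under unions of fewer than $\kappa$ members) and fine ($I_{\kappa,\lambda}\subseteq H$). $\kappa$ is weakly compact if for every $f:\{(\xi,\eta)\in\kappa\times\kappa:\xi<\eta\}\to2$ there is $A\subseteq\kappa$ of order type $\kappa$ such that $f$ is constant on $\{(\xi,\eta)\in A\times A:\xi<\eta\}$. For $A\subseteq P_\kappa(\lambda)$, $[A]^2_\kappa=\{(\bigcup(a\cap\kappa),b):a,b\in A,\ \bigcup(a\cap\kappa)<\bigcup(b\cap\kappa)\}$. For an ideal $H$ on $P_\kappa(\lambda)$, $H^+\xrightarrow{\kappa}(H^+)^2$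 means: for every $F:[P_\kappa(\lambda)]^2_\kappa\to2$ and every $A\in H^+$ there is $B\in H^+\cap P(A)$ such that $F$ is constant on $[B]^2_\kappa$. $\mathbf{cov}(\mathbf{M}_{\kappa,\kappa})$: give ${}^\kappa2$ the topology whose basic open sets are $\emptyset$ and $O_s=\{f\in{}^\kappa2:s\subseteq f\}$ for $s\in\bigcup\{{}^a2:a\in P_\kappa(\kappa)\}$. $\mathbf{M}_{\kappa,\kappa}$ is the set of all $W\subseteq{}^\kappa2$ such that $W\cap\bigcap X=\emptyset$ for some collection $X$ of dense open sets with $0<|X|\le\kappa$. $\mathbf{cov}(\mathbf{M}_{\kappa,\kappa})$ is the least cardinality of a $Y\subseteq\mathbf{M}_{\kappa,\kappa}$ with $\bigcup Y={}^\kappa2$. -}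

module Defs where

-- Classical set theory is read in the universe `Set ℓ`.  The power set of S
-- is S → Bool; under excluded middle and function extensionality at level ℓ
-- this is the full, extensional power set, and it stays in `Set ℓ`.
-- Comprehension is by `Refinement`, whose membership proofs are irrelevant, so
-- that elements of a subset are equal as soon as their values are, and
-- cardinalities of subsets count elements only.

open import Level using (Level; suc; _⊔_; 0ℓ)
open import Data.Bool.Base using (Bool; true; _∨_; T)
open import Data.Nat.Base using (ℕ)
open import Data.Product.Base using (Σ; _×_; _,_; ∃; proj₁; proj₂)
open import Data.Sum.Base using (_⊎_)
open import Data.Refinement.Base using (Refinement; Refinement-syntax; value)
open import Function.Bundles using (_↣_; _⤖_)
open import Induction.WellFounded using (WellFounded)
open import Relation.Binary.Core using (Rel)
open import Relation.Binary.Structures using (IsStrictTotalOrder)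
open import Relation.Binary.Morphism.Structures
  using (IsOrderMonomorphism; IsOrderIsomorphism)
open import Relation.Binary.PropositionalEquality.Core using (_≡_)
open import Relation.Nullary.Negation.Core using (¬_)
open import Relation.Unary using (Pred; _⊆_; _≐_; _≬_; _∩_; ∅; ｛_｝; Empty; Satisfiable)

private
  variable
    a b p q ℓ : Level

------------------------------------------------------------------------
-- Subsets

Subset : Set a → Set a
Subset S = S → Bool

⟦_⟧ : {S : Set a} → Subset S → Pred S 0ℓ
⟦ A ⟧ x = T (A x)

↥ : {S : Set a} → Subset S → Set a
↥ {S = S} A = [ x ∈ S ∣ T (A x) ]

full : {S : Set a} → Subset S
full _ = true

⋃ˢ : {S : Set a} → Subset (Subset S) → Pred S a
⋃ˢ X x = ∃ λ A → ⟦ X ⟧ A × ⟦ A ⟧ x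

⋂ˢ : {S : Set a} → Subset (Subset S) → Pred S a
⋂ˢ X x = ∀ A → ⟦ X ⟧ A → ⟦ A ⟧ x

-- F, defined on the set carved out of S by P, is constant on the part of its
-- domain lying in Q.
ConstantOn : {S : Set a} {P : Pred S p} →
             (Refinement S P → Bool) → Pred S q → Set (a ⊔ p ⊔ q)
ConstantOn F Q = ∃ λ i → ∀ x → Q (value x) → F x ≡ i

------------------------------------------------------------------------
-- Cardinals

infix 4 _≼_ _≺_

_≼_ : Set a → Set b → Set (a ⊔ b)
X ≼ Y = X ↣ Y

_≺_ : Set a → Set b → Set (a ⊔ b)
X ≺ Y = X ≼ Y × ¬ (Y ≼ X)

-- An initial ordinal: a well-order that does not inject into any of its
-- proper initial segments.
record Cardinal ℓ : Set (suc ℓ) where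
  field
    Carrier            : Set ℓ
    _<_                : Rel Carrier ℓ
    isStrictTotalOrder : IsStrictTotalOrder _≡_ _<_
    wellFounded        : WellFounded _<_
    initial            : ∀ α → ¬ (Carrier ≼ [ ξ ∈ Carrier ∣ ξ < α ])

∣_∣ : Cardinal ℓ → Set ℓ
∣ κ ∣ = Cardinal.Carrier κ

-- The inclusion of von Neumann ordinals: an isomorphism onto an initial
-- segment.  There is at most one.
infix 4 _⊆ᵒ_

record _⊆ᵒ_ (κ μ : Cardinal ℓ) : Set ℓ where
  private
    module κ = Cardinal κ
    module μ = Cardinal μ
  field
    incl                : ∣ κ ∣ → ∣ μ ∣
    isOrderMonomorphism : IsOrderMonomorphism _≡_ _≡_ κ._<_ μ._<_ incl
    downwardClosed      : ∀ ξ η → η μ.< incl ξ → ∃ λ ζ → incl ζ ≡ η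

-- μ is the least cardinality of a subset of S satisfying Q.
IsLeastCardinality : {S : Set ℓ} → Pred (Subset S) ℓ → Cardinal ℓ → Set ℓ
IsLeastCardinality Q μ =
  (∃ λ X → Q X × (↥ X ⤖ ∣ μ ∣)) × (∀ X → Q X → ∣ μ ∣ ≼ ↥ X)

module _ (κ : Cardinal ℓ) where
  open Cardinal κ

  Cofinal : Pred (Subset ∣ κ ∣) ℓ
  Cofinal A = ∀ α → ∃ λ ξ → ⟦ A ⟧ ξ × (α < ξ ⊎ α ≡ ξ)

  Uncountable : Set ℓ
  Uncountable = ℕ ≺ ∣ κ ∣

  -- cf κ = κ; meant for infinite κ.
  Regular : Set ℓ
  Regular = IsLeastCardinality Cofinal κ

  HasFullOrderType : Pred (Subset ∣ κ ∣) ℓ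
  HasFullOrderType A = ∃ λ (e : ∣ κ ∣ → ↥ A) →
    IsOrderIsomorphism _≡_ _≡_ _<_ (λ x y → value x < value y) e

  WeaklyCompact : Set ℓ
  WeaklyCompact =
    (f : [ p ∈ ∣ κ ∣ × ∣ κ ∣ ∣ proj₁ p < proj₂ p ] → Bool) →
    ∃ λ A → HasFullOrderType A ×
      ConstantOn f (λ (ξ , η) → ⟦ A ⟧ ξ × ⟦ A ⟧ η)

P[_] : Cardinal ℓ → Set ℓ → Set ℓ
P[ μ ] A = [ a ∈ Subset A ∣ ↥ a ≺ ∣ μ ∣ ]

------------------------------------------------------------------------
-- Ideals

-- Closure under the empty union follows from `singletons` and `subsets`, as S
-- is always inhabited below.
record IsIdeal {S : Set ℓ} (K : Subset (Subset S)) : Set ℓ where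
  field
    singletons : ∀ x A → ⟦ A ⟧ ≐ ｛ x ｝ → ⟦ K ⟧ A
    subsets    : ∀ A B → ⟦ A ⟧ ⊆ ⟦ B ⟧ → ⟦ K ⟧ B → ⟦ K ⟧ A
    unions     : ∀ A B → ⟦ K ⟧ A → ⟦ K ⟧ B → ⟦ K ⟧ (λ x → A x ∨ B x)
    proper     : ¬ ⟦ K ⟧ full

Positive : {S : Set ℓ} → Subset (Subset S) → Pred (Subset S) 0ℓ
Positive K A = ¬ ⟦ K ⟧ A

Generates : {S : Set ℓ} → Subset (Subset S) → Pred (Subset (Subset S)) ℓ
Generates K X =
  ⟦ X ⟧ ⊆ ⟦ K ⟧ × (⟦ K ⟧ ≐ λ B → ∃ λ A → ⟦ X ⟧ A × ⟦ B ⟧ ⊆ ⟦ A ⟧)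

IsCof : {S : Set ℓ} → Subset (Subset S) → Cardinal ℓ → Set ℓ
IsCof K = IsLeastCardinality (Generates K)

Complete : Cardinal ℓ → {S : Set ℓ} → Subset (Subset S) → Set ℓ
Complete κ K =
  ∀ X U → ⟦ X ⟧ ⊆ ⟦ K ⟧ → ↥ X ≺ ∣ κ ∣ → ⟦ U ⟧ ≐ ⋃ˢ X → ⟦ K ⟧ U

------------------------------------------------------------------------
-- Ideals on P_κ(Λ) and the partition relation

module _ (κ Λ : Cardinal ℓ) where

  -- I_{κ,Λ}
  Bounded : Pred (Subset (P[ κ ] ∣ Λ ∣)) ℓ
  Bounded A = ∃ λ (a : P[ κ ] ∣ Λ ∣) →
    Empty (⟦ A ⟧ ∩ λ b → ⟦ value a ⟧ ⊆ ⟦ value b ⟧)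

  record IsIdealOnP (H : Subset (Subset (P[ κ ] ∣ Λ ∣))) : Set ℓ where
    field
      isIdeal  : IsIdeal H
      complete : Complete κ H
      fine     : Bounded ⊆ ⟦ H ⟧

module _ (κ Λ : Cardinal ℓ) (κ⊆Λ : κ ⊆ᵒ Λ) where
  open Cardinal κ using (_<_)
  open _⊆ᵒ_ κ⊆Λ using (incl)

  -- α = ⋃ (a ∩ κ), ordinals being the sets of their predecessors.
  IsSup : P[ κ ] ∣ Λ ∣ → ∣ κ ∣ → Set ℓ
  IsSup a α = (_< α) ≐ λ η → ∃ λ ξ → ⟦ value a ⟧ (incl ξ) × η < ξ

  -- [A]²_κ
  Pairs : Subset (P[ κ ] ∣ Λ ∣) → Pred (∣ κ ∣ × P[ κ ] ∣ Λ ∣) ℓ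
  Pairs A (α , b) = ∃ λ a → ∃ λ β →
    ⟦ A ⟧ a × ⟦ A ⟧ b × IsSup a α × IsSup b β × α < β

  -- H⁺ →^κ (H⁺)²
  Arrow : Subset (Subset (P[ κ ] ∣ Λ ∣)) → Set ℓ
  Arrow H =
    (F : Refinement (∣ κ ∣ × P[ κ ] ∣ Λ ∣) (Pairs full) → Bool) →
    ∀ A → Positive H A →
    ∃ λ B → Positive H B × ⟦ B ⟧ ⊆ ⟦ A ⟧ × ConstantOn F (Pairs B)

------------------------------------------------------------------------
-- The covering number of the ideal M_{κ,κ}

module _ (κ : Cardinal ℓ) where

  2^κ : Set ℓ
  2^κ = ∣ κ ∣ → Bool

  data BasicOpen : Set ℓ where
    none : BasicOpen
    O    : (a : P[ κ ] ∣ κ ∣) (s : ↥ (value a) → Bool) → BasicOpen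

  points : BasicOpen → Pred 2^κ ℓ
  points none    f = Level.Lift _ (∅ f)
  points (O a s) f = ∀ ξ → f (value ξ) ≡ s ξ

  Open : Pred (Subset 2^κ) ℓ
  Open U = ∀ f → ⟦ U ⟧ f → ∃ λ B → points B f × points B ⊆ ⟦ U ⟧

  Dense : Pred (Subset 2^κ) ℓ
  Dense D = ∀ U → Open U → Satisfiable ⟦ U ⟧ → ⟦ D ⟧ ≬ ⟦ U ⟧

  -- M_{κ,κ}
  Meager : Pred (Subset 2^κ) ℓ
  Meager W = ∃ λ X →
    (∀ U → ⟦ X ⟧ U → Dense U × Open U) ×
    Satisfiable ⟦ X ⟧ × (↥ X ≼ ∣ κ ∣) ×
    Empty (⟦ W ⟧ ∩ ⋂ˢ X)

  IsMeagerCover : Pred (Subset (Subset 2^κ)) ℓ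
  IsMeagerCover Y = (∀ W → ⟦ Y ⟧ W → Meager W) × (∀ f → ⋃ˢ Y f)

  IsCovM : Cardinal ℓ → Set ℓ
  IsCovM = IsLeastCardinality IsMeagerCover

{-# OPTIONS --safe #-}
module Submission where

-- For b ∈ A let t b : κ → 2 be ξ ↦ F(ξ, b).  By weak compactness there is f : κ → 2
-- such that every cylinder {b ∈ A : ⋃(b ∩ κ) ≥ α, t b agrees with f below α} is
-- positive: a homogeneous set for the lexicographic comparison of a κ-sequence in 2^κ
-- makes it converge coordinatewise, which shows first that some s gives a positive
-- cylinder at each level α, and then that such s can be taken coherent.  A colour i can
-- be fixed so that the cylinders stay positive when f(⋃(b ∩ κ)) = i is demanded.  Each
-- g ∈ 2^κ now carves out a set B_g ⊆ A on which F is constantly i, and for N ∈ H the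
-- set of g with B_g ⊈ N is open dense.  As cof(H) < cov(M_{κ,κ}), one g works for all N
-- in a generating family of H, so B_g is positive.

open import Defs
open import Axiom.ExcludedMiddle using (ExcludedMiddle)
open import Axiom.Extensionality.Propositional using (Extensionality; implicit-extensionality)
open import Data.Bool.Base using (Bool; true; false; _∨_; not; T)
open import Data.Bool.Properties using (T-≡; T-∨; ¬-not) renaming (_≟_ to _≟ᵇ_)
open import Data.Irrelevant using ([_])
open import Data.Product.Base using (_×_; _,_; ∃; proj₁; proj₂)
open import Data.Refinement.Base using (Refinement; Refinement-syntax; value; _,_)
open import Data.Sum.Base using (_⊎_; inj₁; inj₂)
open import Data.Unit.Polymorphic.Base using (⊤; tt)
open import Function.Base using (_∘_; case_of_)
open import Function.Bundles using (mk↣; Injection; Bijection; Equivalence)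
open import Function.Construct.Composition using (_↣-∘_)
open import Induction.WellFounded using (WfRec; module All; module FixPoint)
open import Relation.Binary.Definitions using (tri<; tri≈; tri>)
open import Relation.Binary.Morphism.Structures using (IsOrderMonomorphism; IsOrderIsomorphism)
open import Relation.Binary.PropositionalEquality
open import Relation.Binary.Structures using (IsStrictTotalOrder)
open import Relation.Nullary using (yes; no; ¬_; contradiction)
open import Relation.Nullary.Decidable
  using (⌊_⌋; toWitness; fromWitness; recompute; decidable-stable; T?)
open import Relation.Unary using (Pred; _⊆_)

-- Comprehension, ranges and positive sets.

⊤-≼ : ∀ {a} {S : Set a} → S → ⊤ {a} ≼ S
⊤-≼ x = mk↣ {to = λ _ → x} λ _ → refl

value-≡ : ∀ {a p} {S : Set a} {P : Pred S p} {x y : Refinement S P} →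
          value x ≡ value y → x ≡ y
value-≡ refl = refl

T⇒true : ∀ {b} → T b → b ≡ true
T⇒true = Equivalence.to T-≡

true⇒T : ∀ {b} → b ≡ true → T b
true⇒T = Equivalence.from T-≡

¬T-not : ∀ b → ¬ T (not b) → T b
¬T-not true _ = _
¬T-not false ¬⊤ = ¬⊤ _

module _ {ℓ} (em : ExcludedMiddle ℓ) where

  dne : {P : Set ℓ} → ¬ ¬ P → P
  dne = decidable-stable em

  set : {S : Set ℓ} → Pred S ℓ → Subset S
  set P x = ⌊ em {P x} ⌋

  set⁺ : {S : Set ℓ} (P : Pred S ℓ) {x : S} → P x → ⟦ set P ⟧ x
  set⁺ P = fromWitness

  set⁻ : {S : Set ℓ} (P : Pred S ℓ) {x : S} → ⟦ set P ⟧ x → P x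
  set⁻ P = toWitness

  range : {I S : Set ℓ} → (I → S) → Subset S
  range h = set λ x → ∃ λ i → h i ≡ x

  range⁺ : {I S : Set ℓ} (h : I → S) (i : I) → ⟦ range h ⟧ (h i)
  range⁺ h i = fromWitness (i , refl)

  range⁻ : {I S : Set ℓ} (h : I → S) {x : S} → ⟦ range h ⟧ x → ∃ λ i → h i ≡ x
  range⁻ h = toWitness

  range-≼ : {I S : Set ℓ} (h : I → S) → ↥ (range h) ≼ I
  range-≼ {I} {S} h = mk↣ {to = proj₁ ∘ index} λ {x} {y} eq →
    value-≡ (trans (sym (proj₂ (index x))) (trans (cong h eq) (proj₂ (index y))))
    where
    index : (x : ↥ (range h)) → ∃ λ i → h i ≡ value x
    -- Membership is irrelevant, so `recompute em` rebuilds an index, one that depends on `x` alone.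
    index (x , [ p ]) = recompute em (range⁻ h p)

  module _ {S : Set ℓ} {H : Subset (Subset S)} (isIdeal : IsIdeal H) where
    open IsIdeal isIdeal

    positive-∖ : ∀ {A N} → Positive H A → ⟦ H ⟧ N → ∃ λ x → ⟦ A ⟧ x × ¬ ⟦ N ⟧ x
    positive-∖ {A} {N} A⁺ N∈H = dne λ absent → A⁺ (subsets A N
      (λ {x} x∈A → decidable-stable (T? (N x)) λ x∉N → absent (x , x∈A , x∉N)) N∈H)

    positive-⊆ : ∀ {A B} → ⟦ A ⟧ ⊆ ⟦ B ⟧ → Positive H A → Positive H B
    positive-⊆ {A} {B} A⊆B A⁺ B∈H = A⁺ (subsets A B A⊆B B∈H)

    positive-∪ : ∀ {A B C} → (∀ {x} → ⟦ A ⟧ x → ⟦ B ⟧ x ⊎ ⟦ C ⟧ x) →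
                 Positive H A → ¬ (⟦ H ⟧ B × ⟦ H ⟧ C)
    positive-∪ {A} {B} {C} A⊆ A⁺ (B∈H , C∈H) =
      A⁺ (subsets A (λ x → B x ∨ C x) (Equivalence.from T-∨ ∘ A⊆) (unions B C B∈H C∈H))

  -- Bounds, recursion and small unions at a regular cardinal.

  module RegularCardinal
    (κ : Cardinal ℓ) (regular : Regular κ) (uncountable : Uncountable κ) where

    open Cardinal κ
    open IsStrictTotalOrder isStrictTotalOrder
      using (compare; irrefl; asym) renaming (trans to <-trans)

    <-irrefl : ∀ {α} → ¬ α < α
    <-irrefl = irrefl refl

    <-≮-trans : ∀ {α β γ} → α < β → ¬ γ < β → α < γ
    <-≮-trans {α} {β} {γ} α<β γ≮β with compare β γ
    ... | tri< β<γ _ _ = <-trans α<β β<γ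
    ... | tri≈ _ refl _ = α<β
    ... | tri> _ _ γ<β = contradiction γ<β γ≮β

    least : (P : Pred ∣ κ ∣ ℓ) → ∃ P → ∃ λ α → P α × ∀ ξ → ξ < α → ¬ P ξ
    least P (α , Pα) = dne λ absent →
      All.wfRec wellFounded ℓ (λ α → ¬ P α)
        (λ α ih Pα → absent (α , Pα , λ ξ ξ<α → ih ξ<α)) α Pα

    0ᵏ : ∣ κ ∣
    0ᵏ = Injection.to (proj₁ uncountable) 0

    ¬κ≼⊤ : ¬ (∣ κ ∣ ≼ ⊤ {ℓ})
    ¬κ≼⊤ κ≼⊤ = case Injection.injective (proj₁ uncountable) {0} {1}
      (Injection.injective κ≼⊤ refl) of λ ()

    ≼-segment : ∀ {X : Set ℓ} {α} → X ≼ [ ξ ∈ ∣ κ ∣ ∣ ξ < α ] → X ≺ ∣ κ ∣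
    ≼-segment X≼α = mk↣ {to = value} value-≡ ↣-∘ X≼α , λ κ≼X → initial _ (X≼α ↣-∘ κ≼X)

    singleton-≺ : ∀ {S : Set ℓ} (x : S) → ↥ (range {⊤} λ _ → x) ≺ ∣ κ ∣
    singleton-≺ x = ⊤-≼ 0ᵏ ↣-∘ range-≼ _ , λ κ≼ → ¬κ≼⊤ (range-≼ _ ↣-∘ κ≼)

    -- A set without a strict upper bound is cofinal, so regularity embeds `κ` into it.
    bounded : (X : Subset ∣ κ ∣) → ¬ (∣ κ ∣ ≼ ↥ X) → ∃ λ α → ∀ ξ → ⟦ X ⟧ ξ → ξ < α
    bounded X κ⋠X = dne λ unbounded → κ⋠X (proj₂ regular X λ α → dne λ absent →
      unbounded (α , λ ξ ξ∈X → case compare ξ α of λ where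
        (tri< ξ<α _ _) → ξ<α
        (tri≈ _ ξ≡α _) → contradiction (ξ , ξ∈X , inj₂ (sym ξ≡α)) absent
        (tri> _ _ α<ξ) → contradiction (ξ , ξ∈X , inj₁ α<ξ) absent))

    above : ∀ α → ∃ λ β → α < β
    above α = let β , bound = bounded (range {⊤} λ _ → α) (proj₂ (singleton-≺ α))
              in β , bound α (range⁺ {⊤} (λ _ → α) tt)

    above₂ : ∀ α β → ∃ λ γ → α < γ × β < γ
    above₂ α β with compare α β
    ... | tri< α<β _ _ = let γ , β<γ = above β in γ , <-trans α<β β<γ , β<γ
    ... | tri≈ _ refl _ = let γ , β<γ = above β in γ , β<γ , β<γ
    ... | tri> _ _ β<α = let γ , α<γ = above α in γ , α<γ , <-trans β<α α<γ

    -- One witness per `ξ < α` makes a set of fewer than `κ` ordinals, and such a set is bounded.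
    uniform-bound : (Q : ∣ κ ∣ → Pred ∣ κ ∣ ℓ) →
      (∀ {ξ γ γ′} → γ < γ′ → Q ξ γ → Q ξ γ′) →
      ∀ α → (∀ {ξ} → ξ < α → ∃ (Q ξ)) → ∃ λ γ → ∀ {ξ} → ξ < α → Q ξ γ
    uniform-bound Q upward α Qξ = γ , λ {ξ} ξ<α →
      upward (γ-bound (pick ξ) (range⁺ picks (ξ , [ ξ<α ]))) (pick-Q ξ (Qξ ξ<α))
      where
      pick : ∣ κ ∣ → ∣ κ ∣
      -- Deciding `∃ (Q ξ)` frees the witness from the proof of `ξ < α`; the default `0ᵏ` never
      -- occurs below `α`.
      pick ξ with em {∃ (Q ξ)}
      ... | yes (γ , _) = γ
      ... | no _ = 0ᵏ

      pick-Q : ∀ ξ → ∃ (Q ξ) → Q ξ (pick ξ)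
      pick-Q ξ q with em {∃ (Q ξ)}
      ... | yes (_ , Qξγ) = Qξγ
      ... | no ¬q = contradiction q ¬q

      picks : [ ξ ∈ ∣ κ ∣ ∣ ξ < α ] → ∣ κ ∣
      picks = pick ∘ value

      γ : ∣ κ ∣
      γ = proj₁ (bounded (range picks) (proj₂ (≼-segment (range-≼ picks))))

      γ-bound : ∀ ξ → ⟦ range picks ⟧ ξ → ξ < γ
      γ-bound = proj₂ (bounded (range picks) (proj₂ (≼-segment (range-≼ picks))))

    mono-inflationary : (e : ∣ κ ∣ → ∣ κ ∣) → (∀ {α β} → α < β → e α < e β) →
                        ∀ α → ¬ e α < α
    mono-inflationary e mono = All.wfRec wellFounded ℓ (λ α → ¬ e α < α)
      λ α ih eα<α → ih eα<α (mono eα<α)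

    small-union : {S : Set ℓ} {H : Subset (Subset S)} → Complete κ H →
      ∀ γ (C : ∣ κ ∣ → Subset S) → (∀ δ → ⟦ H ⟧ (C δ)) →
      ⟦ H ⟧ (set λ x → ∃ λ δ → δ < γ × ⟦ C δ ⟧ x)
    small-union {S} {H} complete γ C C∈H =
      complete (range members) (set InSome)
        (λ {D} D∈ → let _ , eq = range⁻ members D∈ in subst ⟦ H ⟧ eq (C∈H _))
        (≼-segment (range-≼ members))
        ( (λ x∈ → let δ , δ<γ , x∈Cδ = set⁻ InSome x∈
                  in C δ , range⁺ members (δ , [ δ<γ ]) , x∈Cδ)
        , λ { (D , D∈ , x∈D) → set⁺ InSome (from-member D∈ x∈D) })
      where
      members : [ δ ∈ ∣ κ ∣ ∣ δ < γ ] → Subset S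
      members = C ∘ value

      InSome : Pred S ℓ
      InSome x = ∃ λ δ → δ < γ × ⟦ C δ ⟧ x

      from-member : ∀ {D x} → ⟦ range members ⟧ D → ⟦ D ⟧ x → InSome x
      from-member D∈ x∈D with range⁻ members D∈
      ... | (δ , [ δ<γ ]) , refl = δ , recompute em δ<γ , x∈D

    -- At stage γ the hypothesis is applied to a c that is junk from γ on.
    avoiding-sequence : Extensionality ℓ ℓ → {V : Set ℓ} → V → (R : V → V → Set ℓ) →
      (∀ γ (c : ∣ κ ∣ → V) → ∃ λ v → ∀ {δ} → δ < γ → R (c δ) v) →
      ∃ λ (c : ∣ κ ∣ → V) → ∀ {δ γ} → δ < γ → R (c δ) (c γ)
    avoiding-sequence ext {V} v₀ R avoid = c , λ {δ} {γ} δ<γ →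
      subst₂ R (total-< c δ<γ) (sym unfold)
        (proj₂ (avoid γ (total γ λ _ → c _)) δ<γ)
      where
      total : ∀ γ → WfRec _<_ (λ _ → V) γ → ∣ κ ∣ → V
      total γ ih δ with em {δ < γ}
      ... | yes δ<γ = ih δ<γ
      ... | no _ = v₀

      total-< : ∀ (c : ∣ κ ∣ → V) {γ δ} → δ < γ → total γ (λ {δ} _ → c δ) δ ≡ c δ
      total-< c {γ} {δ} δ<γ with em {δ < γ}
      ... | yes _ = refl
      ... | no δ≮γ = contradiction δ<γ δ≮γ

      step : ∀ γ → WfRec _<_ (λ _ → V) γ → V
      step γ ih = proj₁ (avoid γ (total γ ih))

      open FixPoint wellFounded (λ _ → V) step
        (λ γ eq → cong (step γ) (implicit-extensionality ext (ext eq)))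

      c : ∣ κ ∣ → V
      c = All.wfRec wellFounded ℓ (λ _ → V) step

      unfold : ∀ {γ} → c γ ≡ step γ (λ _ → c _)
      unfold = unfold-wfRec

    -- The space 2^κ: lexicographic convergence and meager sets.

    _≈[_]_ : 2^κ κ → ∣ κ ∣ → 2^κ κ → Set ℓ
    s ≈[ α ] t = ∀ {ξ} → ξ < α → s ξ ≡ t ξ

    _<ˡᵉˣ_ : 2^κ κ → 2^κ κ → Set ℓ
    s <ˡᵉˣ t = ∃ λ ξ → s ≈[ ξ ] t × s ξ ≡ false × t ξ ≡ true

    -- Two sequences have at most one first difference, and the one at `α` goes the wrong way.
    ≮ˡᵉˣ : ∀ {s t α} → s ≈[ α ] t → s α ≡ true → t α ≡ false → ¬ s <ˡᵉˣ t
    ≮ˡᵉˣ {α = α} s≈t sα tα (ξ , s≈t′ , sξ , tξ) with compare ξ α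
    ... | tri< ξ<α _ _ = case trans (sym sξ) (trans (s≈t ξ<α) tξ) of λ ()
    ... | tri≈ _ refl _ = case trans (sym sξ) sα of λ ()
    ... | tri> _ _ α<ξ = case trans (sym sα) (trans (s≈t′ α<ξ) tα) of λ ()

    -- Along a lexicographically monotone κ-sequence each coordinate is eventually
    -- constant: once the earlier coordinates have settled, it changes at most once.
    lex-monotone-converges : (u : ∣ κ ∣ → 2^κ κ) (d : Bool) →
      (∀ {α γ γ′} → γ < γ′ → u γ ≈[ α ] u γ′ → u γ α ≡ d → u γ′ α ≡ d) →
      ∃ λ f → ∀ α → ∃ λ γ₀ → ∀ {γ} → γ₀ < γ → u γ ≈[ α ] f
    lex-monotone-converges u d persists = f , λ α →
      let γ₀ , settled = uniform-bound Limit
            (λ γ<γ′ lim γ′<δ → lim (<-trans γ<γ′ γ′<δ)) α (λ {ξ} _ → limit ξ)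
      in γ₀ , λ γ₀<γ ξ<α → settled ξ<α γ₀<γ
      where
      Settled : ∣ κ ∣ → Pred ∣ κ ∣ ℓ
      Settled α γ₀ = ∀ {γ γ′} → γ₀ < γ → γ₀ < γ′ → u γ α ≡ u γ′ α

      settle-step : ∀ α → WfRec _<_ (λ α → ∃ (Settled α)) α → ∃ (Settled α)
      -- Past `γ₀` the earlier coordinates are fixed, so the value `d` persists once reached; if
      -- never reached, the coordinate is constantly the other bit.
      settle-step α ih = case em {∃ λ γ₁ → γ₀ < γ₁ × u γ₁ α ≡ d} of λ where
          (yes (γ₁ , γ₀<γ₁ , uγ₁α≡d)) → γ₁ , λ γ₁<γ γ₁<γ′ →
            trans (stays γ₀<γ₁ uγ₁α≡d γ₁<γ) (sym (stays γ₀<γ₁ uγ₁α≡d γ₁<γ′))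
          (no never) → γ₀ , λ γ₀<γ γ₀<γ′ →
            trans (¬-not λ eq → never (_ , γ₀<γ , eq))
              (sym (¬-not λ eq → never (_ , γ₀<γ′ , eq)))
        where
        earlier : ∃ λ γ₀ → ∀ {ξ} → ξ < α → Settled ξ γ₀
        earlier = uniform-bound Settled
          (λ γ<γ′ s γ′<δ γ′<δ′ → s (<-trans γ<γ′ γ′<δ) (<-trans γ<γ′ γ′<δ′)) α ih

        γ₀ : ∣ κ ∣
        γ₀ = proj₁ earlier

        stays : ∀ {γ γ′} → γ₀ < γ → u γ α ≡ d → γ < γ′ → u γ′ α ≡ d
        stays γ₀<γ uγα≡d γ<γ′ = persists γ<γ′
          (λ ξ<α → proj₂ earlier ξ<α γ₀<γ (<-trans γ₀<γ γ<γ′)) uγα≡d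

      settled : ∀ α → ∃ (Settled α)
      settled = All.wfRec wellFounded ℓ (λ α → ∃ (Settled α)) settle-step

      f : 2^κ κ
      f α = u (proj₁ (above (proj₁ (settled α)))) α

      Limit : ∣ κ ∣ → Pred ∣ κ ∣ ℓ
      Limit α γ₀ = ∀ {γ} → γ₀ < γ → u γ α ≡ f α

      limit : ∀ α → ∃ (Limit α)
      limit α = let γ₀ , eq = settled α in γ₀ , λ γ₀<γ → eq γ₀<γ (proj₂ (above γ₀))

    -- Colour a pair of indices by whether `s` increases lexicographically. Along a homogeneous set,
    -- enumerated by `e`, the sequence is monotone and so converges; as `e γ` is never below `γ`,
    -- the limit is met at arbitrarily late indices.
    cofinal-limit : WeaklyCompact κ → (s : ∣ κ ∣ → 2^κ κ) →
      ∃ λ f → ∀ α β → ∃ λ γ → β < γ × s γ ≈[ α ] f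
    cofinal-limit weaklyCompact s = f , λ α β →
      let γ₀ , limit = f-limit α
          γ , γ₀<γ , β<γ = above₂ γ₀ β
      in e γ , <-≮-trans β<γ (mono-inflationary e mono γ) , limit γ₀<γ
      where
      increasing : [ p ∈ ∣ κ ∣ × ∣ κ ∣ ∣ proj₁ p < proj₂ p ] → Bool
      increasing ((γ , γ′) , _) = ⌊ em {s γ <ˡᵉˣ s γ′} ⌋

      homogeneous = weaklyCompact increasing
      module E = IsOrderIsomorphism (proj₂ (proj₁ (proj₂ homogeneous)))

      e′ : ∣ κ ∣ → ↥ (proj₁ homogeneous)
      e′ = proj₁ (proj₁ (proj₂ homogeneous))

      e : ∣ κ ∣ → ∣ κ ∣
      e = value ∘ e′

      mono : ∀ {α β} → α < β → e α < e β
      mono = E.mono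

      e∈ : ∀ α → ⟦ proj₁ homogeneous ⟧ (e α)
      e∈ α with e′ α
      ... | ξ , [ p ] = recompute (T? _) p

      i : Bool
      i = proj₁ (proj₂ (proj₂ homogeneous))

      constant : ∀ {γ γ′} → γ < γ′ → ⌊ em {s (e γ) <ˡᵉˣ s (e γ′)} ⌋ ≡ i
      constant {γ} {γ′} γ<γ′ = proj₂ (proj₂ (proj₂ homogeneous))
        ((e γ , e γ′) , [ mono γ<γ′ ]) (e∈ γ , e∈ γ′)

      -- The colour doubles as the persistent bit: an increase cannot turn true into false at a
      -- first difference, and a non-increase cannot turn false into true.
      persists : ∀ j → (∀ {γ γ′} → γ < γ′ → ⌊ em {s (e γ) <ˡᵉˣ s (e γ′)} ⌋ ≡ j) →
        ∀ {α γ γ′} → γ < γ′ → s (e γ) ≈[ α ] s (e γ′) → s (e γ) α ≡ j → s (e γ′) α ≡ j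
      persists true con γ<γ′ agree eq = ¬-not λ eq′ →
        ≮ˡᵉˣ agree eq eq′ (toWitness (true⇒T (con γ<γ′)))
      persists false con γ<γ′ agree eq = ¬-not λ eq′ →
        case trans (sym (con γ<γ′)) (T⇒true (fromWitness (_ , agree , eq , eq′))) of λ ()

      converges = lex-monotone-converges (s ∘ e) i (persists i constant)

      f : 2^κ κ
      f = proj₁ converges

      f-limit : ∀ α → ∃ λ γ₀ → ∀ {γ} → γ₀ < γ → s (e γ) ≈[ α ] f
      f-limit = proj₂ converges

    -- Otherwise the range of `W` is a meager cover, and minimality embeds `ν` into it and hence
    -- into `I`.
    avoid-meager : ∀ {ν} → IsCovM κ ν → {I : Set ℓ} → ¬ (∣ ν ∣ ≼ I) →
      (W : I → Subset (2^κ κ)) → (∀ i → Meager κ (W i)) → ∃ λ g → ∀ i → ¬ ⟦ W i ⟧ g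
    avoid-meager covM ν⋠I W meager = dne λ absent →
      ν⋠I (range-≼ W ↣-∘ proj₂ covM (range W)
        ( (λ V V∈ → let i , eq = range⁻ W V∈ in subst (Meager κ) eq (meager i))
        , λ g → dne λ uncovered → absent (g , λ i g∈ → uncovered (W i , range⁺ W i , g∈))))

    complement-meager : ∀ {D} → Dense κ D → Open κ D → Meager κ (not ∘ D)
    complement-meager {D} dense open′ =
      range only ,
      (λ U U∈ → subst (λ U → Dense κ U × Open κ U) (proj₂ (range⁻ only U∈)) (dense , open′)) ,
      (D , range⁺ only tt) ,
      (⊤-≼ 0ᵏ ↣-∘ range-≼ only) ,
      λ g (g∉D , g∈) → T-not⁻ (D g) g∉D (g∈ D (range⁺ only tt))
      where
      only : ⊤ → Subset (2^κ κ)
      only _ = D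

      T-not⁻ : ∀ b → T (not b) → ¬ T b
      T-not⁻ false _ ()

    segment : ∣ κ ∣ → P[ κ ] ∣ κ ∣
    segment α = set (_< α) , [ ≼-segment (mk↣ {to = λ (ξ , [ p ]) → ξ , [ set⁻ (_< α) p ]}
      λ eq → value-≡ (cong value eq)) ]

    -- Positive cylinders for an abstract rank.

    module RankedIdeal {S : Set ℓ} {H : Subset (Subset S)}
      (isIdeal : IsIdeal H) (complete : Complete κ H)
      (rank : S → ∣ κ ∣) (low∈H : ∀ α → ⟦ H ⟧ (set λ x → rank x < α))
      (t : S → 2^κ κ) {A : Subset S} (A⁺ : Positive H A) where

      open IsIdeal isIdeal

      InCylinder : 2^κ κ → ∣ κ ∣ → Pred S ℓ
      InCylinder s α x = ⟦ A ⟧ x × ¬ rank x < α × t x ≈[ α ] s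

      -- If every cylinder at level `α` were in `H`, fewer than `κ` of them could not cover `A`, by
      -- completeness. Recursion would then give `κ` points whose `t` pairwise differ below `α`, but
      -- `cofinal-limit` finds two that agree there.
      positive-cylinder : Extensionality ℓ ℓ → WeaklyCompact κ →
        ∀ α → ∃ λ s → Positive H (set (InCylinder s α))
      positive-cylinder ext weaklyCompact α = dne λ absent →
        let c , distinct = avoiding-sequence ext (proj₁ (positive-∖ isIdeal A⁺ (low∈H 0ᵏ)))
              (λ x y → ¬ t y ≈[ α ] t x) (avoid absent)
            f , limit = cofinal-limit weaklyCompact (t ∘ c)
            γ₁ , _ , t₁≈f = limit α 0ᵏ
            γ₂ , γ₁<γ₂ , t₂≈f = limit α γ₁
        in distinct γ₁<γ₂ λ ξ<α → trans (t₂≈f ξ<α) (sym (t₁≈f ξ<α))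
        where
        avoid : ¬ (∃ λ s → Positive H (set (InCylinder s α))) →
          ∀ γ (c : ∣ κ ∣ → S) → ∃ λ y → ∀ {δ} → δ < γ → ¬ t y ≈[ α ] t (c δ)
        avoid absent γ c = y , λ δ<γ agree → y∉ (Equivalence.from T-∨ (inj₁
            (set⁺ InSome (_ , δ<γ , set⁺ (InCylinder _ α) (y∈A , high , agree)))))
          where
          InSome : Pred S ℓ
          InSome x = ∃ λ δ → δ < γ × ⟦ set (InCylinder (t (c δ)) α) ⟧ x

          some∈H : ⟦ H ⟧ (set InSome)
          some∈H = small-union complete γ (λ δ → set (InCylinder (t (c δ)) α))
            λ δ → decidable-stable (T? _) λ pos → absent (_ , pos)

          -- Low ranks are avoided too, so that agreement with some `c δ` would by itself put `y` in
          -- a cylinder.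
          escape = positive-∖ isIdeal A⁺ (unions (set InSome) _ some∈H (low∈H α))
          y = proj₁ escape
          y∈A = proj₁ (proj₂ escape)
          y∉ = proj₂ (proj₂ escape)

          high : ¬ rank y < α
          high ry<α = y∉ (Equivalence.from (T-∨ {set InSome y})
            (inj₂ (set⁺ (λ x → rank x < α) ry<α)))

      -- The sequences chosen at different levels need not cohere. Their cofinal limit `f` agrees
      -- below `α` with the one chosen at some `γ` above `α`, whose positive cylinder then lies in
      -- that of `f`.
      positive-branch : Extensionality ℓ ℓ → WeaklyCompact κ →
        ∃ λ f → ∀ α → Positive H (set (InCylinder f α))
      positive-branch ext weaklyCompact =
        let f , limit = cofinal-limit weaklyCompact (proj₁ ∘ cyl)
        in f , λ α →
          let γ , α<γ , sγ≈f = limit α α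
          in positive-⊆ isIdeal
               {set (InCylinder (proj₁ (cyl γ)) γ)} {set (InCylinder f α)}
               (λ x∈ →
               let x∈A , high , agree = set⁻ (InCylinder (proj₁ (cyl γ)) γ) x∈
               in set⁺ (InCylinder f α)
                    ( x∈A , (λ rx<α → high (<-trans rx<α α<γ))
                    , λ ξ<α → trans (agree (<-trans ξ<α α<γ)) (sγ≈f ξ<α)))
               (proj₂ (cyl γ))
        where
        cyl : ∀ α → ∃ λ s → Positive H (set (InCylinder s α))
        cyl = positive-cylinder ext weaklyCompact

      InColour : 2^κ κ → Bool → ∣ κ ∣ → Pred S ℓ
      InColour f i α x = InCylinder f α x × f (rank x) ≡ i

      -- If the two colours failed at `α` and `β`, the cylinder at a level above both would split
      -- into two sets in `H`.
      positive-colour : ∀ {f} → (∀ α → Positive H (set (InCylinder f α))) →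
        ∃ λ i → ∀ α → Positive H (set (InColour f i α))
      positive-colour {f} branch = dne λ absent →
        absent (true , λ α E₁∈H → absent (false , λ β E₀∈H →
          let γ , α<γ , β<γ = above₂ α β
          in positive-∪ isIdeal
               {set (InCylinder f γ)} {set (InColour f true α)} {set (InColour f false β)}
               (split α<γ β<γ) (branch γ) (E₁∈H , E₀∈H)))
        where
        shrink : ∀ {i α γ x} → α < γ → InColour f i γ x → InColour f i α x
        shrink α<γ ((x∈A , high , agree) , col) =
          (x∈A , (λ rx<α → high (<-trans rx<α α<γ)) , λ ξ<α → agree (<-trans ξ<α α<γ)) , col

        split : ∀ {α β γ x} → α < γ → β < γ → ⟦ set (InCylinder f γ) ⟧ x →
                ⟦ set (InColour f true α) ⟧ x ⊎ ⟦ set (InColour f false β) ⟧ x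
        split {α} {β} {γ} {x} α<γ β<γ x∈ with f (rank x) ≟ᵇ true
        ... | yes col =
          inj₁ (set⁺ (InColour f true α) (shrink α<γ (set⁻ (InCylinder f γ) x∈ , col)))
        ... | no ¬col =
          inj₂ (set⁺ (InColour f false β)
            (shrink β<γ (set⁻ (InCylinder f γ) x∈ , ¬-not ¬col)))

      -- Homogeneous sets from generic points of 2^κ.

      module Generic {f : 2^κ κ} {i : Bool}
        (colour : ∀ α → Positive H (set (InColour f i α))) where

        -- The last clause ranges over all `ξ` that pass the tests by `f` and `g` imposed on ranks
        -- of members, so homogeneity is built in without the set referring to itself.
        Chosen : 2^κ κ → Pred S ℓ
        Chosen g x = ⟦ A ⟧ x × f (rank x) ≡ i × g (rank x) ≡ true ×
          (∀ {ξ} → ξ < rank x → f ξ ≡ i → g ξ ≡ true → t x ξ ≡ i)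

        Escapes : Subset S → Pred (2^κ κ) ℓ
        Escapes N g = ∃ λ x → Chosen g x × ¬ ⟦ N ⟧ x

        -- Whether `x` is chosen depends only on the values of `g` up to and including `rank x`.
        escapes-open : ∀ N → Open κ (set (Escapes N))
        escapes-open N g g∈ with set⁻ (Escapes N) g∈
        ... | x , (x∈A , col , gr , hom) , x∉N =
          let β , r<β = above (rank x) in
          O (segment β) (g ∘ value) , (λ _ → refl) , λ {g′} g′≡g →
            let agree : g′ ≈[ β ] g
                agree ξ<β = g′≡g (_ , [ set⁺ (_< β) ξ<β ])
            in set⁺ (Escapes N)
                 ( x , (x∈A , col , trans (agree r<β) gr , λ ξ<r fξ g′ξ →
                     hom ξ<r fξ (trans (sym (agree (<-trans ξ<r r<β))) g′ξ)) , x∉N)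

        -- A condition of length α is extended by zeros up to the rank of some x
        -- in the α-th cylinder; below α, t x agrees with f.
        escapes-dense : ∀ {N} → ⟦ H ⟧ N → Dense κ (set (Escapes N))
        escapes-dense {N} N∈H U U-open (g₀ , g₀∈U) with U-open g₀ g₀∈U
        ... | O (a , [ a≺κ ]) s , g₀∈O , O⊆U =
          g , set⁺ (Escapes N) (x , (x∈A , col , g-rank , hom) , x∉N)
            , O⊆U λ (ξ , [ ξ∈a ]) →
                trans (g≈g₀ (a<α ξ (recompute (T? _) ξ∈a))) (g₀∈O (ξ , [ ξ∈a ]))
          where
          a-bounded = bounded a (recompute em (proj₂ a≺κ))
          α = proj₁ a-bounded
          a<α = proj₂ a-bounded

          escape = positive-∖ isIdeal (colour α) N∈H
          x = proj₁ escape
          x∉N = proj₂ (proj₂ escape)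
          x∈ = set⁻ (InColour f i α) (proj₁ (proj₂ escape))
          x∈A = proj₁ (proj₁ x∈)
          high = proj₁ (proj₂ (proj₁ x∈))
          agree = proj₂ (proj₂ (proj₁ x∈))
          col = proj₂ x∈

          On : Pred ∣ κ ∣ ℓ
          On ξ = (ξ < α × g₀ ξ ≡ true) ⊎ ξ ≡ rank x

          g : 2^κ κ
          g = set On

          g-rank : g (rank x) ≡ true
          g-rank = T⇒true (set⁺ On (inj₂ refl))

          g≈g₀ : g ≈[ α ] g₀
          g≈g₀ {ξ} ξ<α with g₀ ξ ≟ᵇ true
          ... | yes eq = trans (T⇒true (set⁺ On (inj₁ (ξ<α , eq)))) (sym eq)
          ... | no ¬eq = trans
            (¬-not λ gξ → case set⁻ On (true⇒T gξ) of λ where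
              (inj₁ (_ , eq)) → ¬eq eq
              (inj₂ refl) → high ξ<α)
            (sym (¬-not ¬eq))

          hom : ∀ {ξ} → ξ < rank x → f ξ ≡ i → g ξ ≡ true → t x ξ ≡ i
          hom ξ<r fξ gξ = case set⁻ On (true⇒T gξ) of λ where
            (inj₁ (ξ<α , _)) → trans (agree ξ<α) fξ
            (inj₂ refl) → contradiction ξ<r <-irrefl

        -- A set in `H` lies inside a generator, so it is enough to escape each generator. The `g`
        -- that fail for a given one form a meager set, and there are too few generators for these
        -- to cover 2^κ.
        generic-positive : ∀ {μ ν} → IsCof H μ → IsCovM κ ν → ∣ μ ∣ ≺ ∣ ν ∣ →
          ∃ λ g → Positive H (set (Chosen g))
        generic-positive {ν = ν} ((X , (X⊆H , generates) , X⤖μ) , _) covM (_ , ν⋠μ) =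
          g , λ B∈H → contained (proj₁ generates B∈H)
          where
          Trapped : ↥ X → Subset (2^κ κ)
          Trapped (N , _) = not ∘ set (Escapes N)

          trapped-meager : ∀ N → Meager κ (Trapped N)
          trapped-meager (N , [ N∈X ]) = complement-meager {set (Escapes N)}
            (escapes-dense {N} (X⊆H (recompute (T? (X N)) N∈X))) (escapes-open N)

          ν⋠X : ¬ (∣ ν ∣ ≼ ↥ X)
          ν⋠X ν≼X = ν⋠μ (mk↣ (Bijection.injective X⤖μ) ↣-∘ ν≼X)

          generic : ∃ λ (g : 2^κ κ) → ∀ (N : ↥ X) → ¬ ⟦ Trapped N ⟧ g
          generic = avoid-meager {ν} covM ν⋠X Trapped trapped-meager

          g : 2^κ κ
          g = proj₁ generic

          contained : ¬ ∃ λ (N : Subset S) → ⟦ X ⟧ N × ⟦ set (Chosen g) ⟧ ⊆ ⟦ N ⟧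
          contained (N , N∈X , B⊆N) =
            let x , chosen , x∉N = set⁻ (Escapes N)
                  (¬T-not (set (Escapes N) g) (proj₂ generic (N , [ N∈X ])))
            in x∉N (B⊆N (set⁺ (Chosen g) chosen))

      HomogeneousPositive : Set ℓ
      HomogeneousPositive = ∃ λ (B : Subset S) → Positive H B × ⟦ B ⟧ ⊆ ⟦ A ⟧ ×
        ∃ λ i → ∀ {x y} → ⟦ B ⟧ x → ⟦ B ⟧ y → rank x < rank y → t y (rank x) ≡ i

      homogeneous-positive : ∀ {μ ν} → Extensionality ℓ ℓ → WeaklyCompact κ →
        IsCof H μ → IsCovM κ ν → ∣ μ ∣ ≺ ∣ ν ∣ → HomogeneousPositive
      homogeneous-positive {μ} {ν} ext weaklyCompact cof covM μ≺ν =
        from-branch (positive-branch ext weaklyCompact)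
        where
        from-generic : ∀ {f i} (colour : ∀ α → Positive H (set (InColour f i α))) →
          let open Generic {f} {i} colour in
          (∃ λ g → Positive H (set (Chosen g))) → HomogeneousPositive
        from-generic {f} {i} colour (g , B⁺) =
          set (Chosen g) , B⁺ , (λ {x} x∈B → proj₁ (set⁻ (Chosen g) {x} x∈B)) , i ,
          λ {x} {y} x∈B y∈B rx<ry →
            -- Since `x` is chosen, `rank x` passes the tests in the last clause for `y`.
            let _ , fx , gx , _ = set⁻ (Chosen g) {x} x∈B
                _ , _ , _ , hom = set⁻ (Chosen g) {y} y∈B
            in hom rx<ry fx gx
          where open Generic {f} {i} colour

        from-colour : ∀ {f} → (∃ λ i → ∀ α → Positive H (set (InColour f i α))) →
          HomogeneousPositive
        from-colour {f} (i , colour) = from-generic {f} {i} colour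
          (Generic.generic-positive {f} {i} colour {μ} {ν} cof covM μ≺ν)

        from-branch : (∃ λ f → ∀ α → Positive H (set (InCylinder f α))) →
          HomogeneousPositive
        from-branch (f , branch) = from-colour {f} (positive-colour {f} branch)

    -- The supremum of the trace on κ as a rank.

    module Supremum (Λ : Cardinal ℓ) (κ⊆Λ : κ ⊆ᵒ Λ) where
      open _⊆ᵒ_ κ⊆Λ using (incl; isOrderMonomorphism)

      sup-exists : ∀ b → ∃ (IsSup κ Λ κ⊆Λ b)
      sup-exists (b , [ b≺κ ]) = σ ,
          (λ {η} η<σ → dne λ absent → proj₂ (proj₂ lub) η η<σ λ ξ ξ∈b η<ξ → absent (ξ , ξ∈b , η<ξ)) ,
          λ (ξ , ξ∈b , η<ξ) → <-≮-trans η<ξ (proj₁ (proj₂ lub) ξ ξ∈b)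
        where
        trace : Subset ∣ κ ∣
        trace = b ∘ incl

        trace-≼ : ↥ trace ≼ ↥ b
        trace-≼ = mk↣ {to = λ (ξ , p) → incl ξ , p} λ eq →
          value-≡ (IsOrderMonomorphism.injective isOrderMonomorphism (cong value eq))

        bound = bounded trace λ κ≼ → recompute em (proj₂ b≺κ) (trace-≼ ↣-∘ κ≼)

        -- The bound is not strict: a union of ordinals may equal its largest member.
        lub = least (λ α → ∀ ξ → ⟦ trace ⟧ ξ → ¬ α < ξ)
          (proj₁ bound , λ ξ ξ∈b α<ξ → asym α<ξ (proj₂ bound ξ ξ∈b))
        σ = proj₁ lub

      sup : P[ κ ] ∣ Λ ∣ → ∣ κ ∣
      sup = proj₁ ∘ sup-exists

      -- Both have the same predecessors, so the smaller of two distinct ones would precede itself.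
      sup-unique : ∀ b {α} → IsSup κ Λ κ⊆Λ b α → α ≡ sup b
      sup-unique b {α} isSup with compare α (sup b)
      ... | tri< α<σ _ _ = contradiction (proj₂ isSup (proj₁ (proj₂ (sup-exists b)) α<σ)) <-irrefl
      ... | tri≈ _ α≡σ _ = α≡σ
      ... | tri> _ _ σ<α = contradiction (proj₂ (proj₂ (sup-exists b)) (proj₁ isSup σ<α)) <-irrefl

      -- A `b` containing `incl α` has supremum at least `α`, so the set misses the cone over that
      -- singleton and fineness applies.
      low-sup : ∀ {H} → IsIdealOnP κ Λ H → ∀ α → ⟦ H ⟧ (set λ b → sup b < α)
      low-sup isIdealOnP α = IsIdealOnP.fine isIdealOnP
        ( (range only , [ singleton-≺ (incl α) ])
        , λ b (low , a⊆b) → <-irrefl (proj₂ (proj₂ (sup-exists b))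
            (α , a⊆b (range⁺ only tt) , set⁻ (λ b → sup b < α) {b} low)))
        where
        only : ⊤ → ∣ Λ ∣
        only _ = incl α

-- The partition relation.

theorem13p1 : ∀ {ℓ} → ExcludedMiddle ℓ → Extensionality ℓ ℓ →
    (κ Λ : Cardinal ℓ) (κ⊆Λ : κ ⊆ᵒ Λ) →
    Regular κ → Uncountable κ → ∣ κ ∣ ≺ ∣ Λ ∣ →
    WeaklyCompact κ →
    ∀ H → IsIdealOnP κ Λ H →
    ∀ μ ν → IsCof H μ → IsCovM κ ν → ∣ μ ∣ ≺ ∣ ν ∣ →
    Arrow κ Λ κ⊆Λ H
theorem13p1 em ext κ Λ κ⊆Λ regular uncountable _ weaklyCompact
  H isIdealOnP μ ν cof covM μ≺ν F A A⁺ =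
  arrow (homogeneous-positive {μ} {ν} ext weaklyCompact cof covM μ≺ν)
  where
  open RegularCardinal em κ regular uncountable
  open Supremum Λ κ⊆Λ
  open IsIdealOnP isIdealOnP
  open Cardinal κ using (_<_)

  colours : P[ κ ] ∣ Λ ∣ → 2^κ κ
  -- The default `false` fills in pairs outside the domain of `F`; `arrow` reads `colours` only
  -- inside it.
  colours b α with em {Pairs κ Λ κ⊆Λ full (α , b)}
  ... | yes p = F ((α , b) , [ p ])
  ... | no _ = false

  colours-F : ∀ {α b} (p : Pairs κ Λ κ⊆Λ full (α , b)) → colours b α ≡ F ((α , b) , [ p ])
  colours-F {α} {b} p with em {Pairs κ Λ κ⊆Λ full (α , b)}
  ... | yes _ = refl
  ... | no ¬p = contradiction p ¬p

  open RankedIdeal {H = H} isIdeal complete sup (low-sup isIdealOnP) colours {A} A⁺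

  arrow : HomogeneousPositive →
    ∃ λ B → Positive H B × ⟦ B ⟧ ⊆ ⟦ A ⟧ × ConstantOn F (Pairs κ Λ κ⊆Λ B)
  arrow (B , B⁺ , B⊆A , i , homogeneous) =
    B , B⁺ , (λ {x} → B⊆A {x}) , i , λ where
    ((α , b) , [ _ ]) (a , β , a∈B , b∈B , a-sup , b-sup , α<β) →
      -- The domain proof of the given point is irrelevant, so it may be replaced by one built from
      -- `a` and `β`; then `α` is the rank of `a`.
      trans (sym (colours-F {α} {b} (a , β , _ , _ , a-sup , b-sup , α<β)))
        (subst (λ α → colours b α ≡ i) (sym (sup-unique a a-sup))
          (homogeneous {a} {b} a∈B b∈B
            (subst₂ _<_ (sup-unique a a-sup) (sup-unique b b-sup) α<β)))
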